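{- Let $\phi$ be a CNF formula over a set $X$ of Boolean variables, and let $(S, \chi)$ be a tree decomposition of the Gaifman graph of $\phi$ of width $w$. Then the tree-decomposition algorithm described in the context, on input $X$, $\phi$, $(S,\chi)$, returns a project-join tree of $\phi$ of width at most $w + 1$.
   Context: A CNF formula $\phi$ is a set of clauses; $\mathrm{vars}(c)$ is the set of variables appearing in clause $c$, and $\mathrm{vars}(\phi) = \bigcup_{c \in \phi} \mathrm{vars}(c)$. The Gaifman graph of $\phi$ has a vertex for each variable of $\phi$, and two vertices are adjacent if the corresponding variables appear together in some clause of $\phi$. A tree is a simple, connected, acyclic graph; $\mathcal{V}(T)$ denotes the set of nodes of a tree $T$, a leaf of $T$ is a node of degree one, and $\mathcal{L}(T)$ is the set of leaves of $T$. Nodes that are not leaves are called internal. In a tree with a distinguished root $r$, the set $\mathcal{C}(n)$ of children of a node $n$ consists of all nodes $n'$ adjacent to $n$ such that all paths from $n'$ to $r$ contain $n$. A tree decomposition $(S, \chi)$ of a graph $G$ is a tree $S$ with a labeling function $\chi : \mathcal{V}(S) \to 2^{\mathcal{V}(G)}$ such that every vertex of $G$ lies in some $\chi(n)$, both endpoints of every edge of $G$ lie together in some $\chi(n)$, and for all $n, o, p \in \mathcal{V}(S)$, if $o$ is on the path from $n$ to $p$, then $\chi(n) \cap \chi(p) \subseteq \chi(o)$. Its width is $\max_{n \in \mathcal{V}(S)} |\chi(n)| - 1$. A project-join tree of a CNF formula $\phi$ over $X$ is a tuple $(T, r, \gamma, \pi)$ where $T$ is a tree with root $r \in \mathcal{V}(T)$,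 $\gamma : \mathcal{L}(T) \to \phi$ is a bijection between the leaves of $T$ and the clauses of $\phi$, and $\pi : \mathcal{V}(T) \setminus \mathcal{L}(T) \to 2^X$ is a labeling function on internal nodes, such that: (1) $\{\pi(n) : n \in \mathcal{V}(T) \setminus \mathcal{L}(T)\}$ is a partition of $X$; (2) for each internal node $n$, variable $x \in \pi(n)$, and clause $c \in \phi$ such that $x$ appears in $c$, the leaf $\gamma^{ -1}(c)$ is a descendant of $n$ in $T$. For a node $n$ of $T$: $\mathrm{vars}(n) = \mathrm{vars}(\gamma(n))$ if $n$ is a leaf, and $\mathrm{vars}(n) = \left(\bigcup_{o \in \mathcal{C}(n)} \mathrm{vars}(o)\right) \setminus \pi(n)$ if $n$ is internal. The size of $n$ is $|\mathrm{vars}(n)|$ if $n$ is a leaf and $|\mathrm{vars}(n) \cup \pi(n)|$ if $n$ is internal. The width of the project-join tree is the maximum size of its nodes. Tree-decomposition algorithm (input: a set $X$ of Boolean variables, a CNF formula $\phi$ over $X$, and a tree decomposition $(S, \chi)$ of the Gaifman graph of $\phi$): Start with an empty project-join tree $T$ and a global variable $found = \emptyset$ (the clauses of $\phi$ that have been added to $T$). The recursive procedure $\mathrm{Process}(n, \ell)$, for $n \in \mathcal{V}(S)$ and $\ell \subseteq X$ (variables that must not be projected out here), returns a set of nodes of $T$ as follows: - $clauses := \{c \in \phi : c \notin found \text{ and } \mathrm{vars}(c) \subseteq \chi(n)\}$; then $found := found \cup clauses$; - $children :=$ the set of newly created leaves of $T$, one leaf $p$ with $\gamma(p) = c$ for each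 $c \in clauses$, together with $\bigcup_{o \in \mathcal{C}(n)} \mathrm{Process}(o, \chi(n))$, where $\mathcal{C}(n)$ is the set of children of $n$ in the rooted tree $S$; - if $children = \emptyset$ or $\chi(n) \subseteq \ell$, return $children$; otherwise create a new internal node $o$ of $T$ with set of children $children$ and label $\pi(o) = \chi(n) \setminus \ell$, and return $\{o\}$. The algorithm lets $s$ be an arbitrary node of $S$, fixed as the root of $S$, lets $r$ be the only element of $\mathrm{Process}(s, \emptyset)$, and returns $(T, r, \gamma, \pi)$.
   Formalization: Every variable of X is taken to occur in some clause; a leaf is a node without children, so a root with one child is internal; the result is stated whenever Process(s,∅) returns exactly one node, which is proved when χ(s) is nonempty (an empty root bag may yield several nodes, and empty φ none). -}

module Defs where

open import Data.Bool using (if_then_else_; _∨_)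
open import Data.Fin using (Fin)
import Data.Fin.Properties as Fin
open import Data.Fin.Subset as Subset
  using (Subset; _∪_; _∩_; _─_; ∣_∣; Nonempty) renaming (_∈_ to _∈ˢ_; _∉_ to _∉ˢ_; _⊆_ to _⊆ˢ_)
open import Data.Fin.Subset.Properties using (_⊆?_)
open import Data.Integer using (ℤ; +_; _-_)
open import Data.List using (List; []; _∷_; [_]; _++_; map; filter; length; lookup; null; allFin)
open import Data.List.Extrema.Nat using (max)
open import Data.List.Membership.Propositional using (_∈_)
import Data.List.Membership.DecPropositional as DecMembership
open import Data.List.Relation.Unary.Unique.Propositional using (Unique)
open import Data.Nat using (ℕ; _≤_)
open import Data.Product using (Σ; ∃-syntax; _×_; _,_)
open import Data.Sum using (_⊎_; inj₁; inj₂)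
open import Function using (_⇔_)
open import Function.Definitions using (Injective)
open import Relation.Binary.Construct.Closure.ReflexiveTransitive using (Star; ε; _◅_)
open import Relation.Binary.Construct.Closure.Symmetric using (SymClosure; fwd; bwd; symmetric)
open import Relation.Binary.Definitions using (Symmetric; Irreflexive)
open import Relation.Binary.PropositionalEquality using (_≡_; _≢_; refl; sym)
open import Relation.Nullary using (¬_; does; ¬?; _×-dec_)

record Graph (V : Set) : Set₁ where
  field
    _~_      : V → V → Set
    ~-sym    : Symmetric _~_
    ~-irrefl : Irreflexive _≡_ _~_

module _ {V : Set} (G : Graph V) where
  open Graph G

  Walk : V → V → Set
  Walk = Star _~_

  visited : ∀ {u v} → Walk u v → List V
  visited {u} ε       = [ u ]
  visited {u} (_ ◅ w) = u ∷ visited w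

  IsPath : ∀ {u v} → Walk u v → Set
  IsPath w = Unique (visited w)

  Connected : Set
  Connected = ∀ u v → Walk u v

  -- A path through at least three vertices, closed up by an edge.
  Cycle : Set
  Cycle = ∃[ u ] ∃[ v ] Σ (Walk u v) λ w → IsPath w × 3 ≤ length (visited w) × v ~ u

  IsTree : Set
  IsTree = Connected × ¬ Cycle

  module Rooted (r : V) where

    Child : V → V → Set
    Child n n′ = n ~ n′ × (∀ (w : Walk n′ r) → IsPath w → n ∈ visited w)

    -- Away from the root this is "degree one".  The root is a leaf only if
    -- it is the whole tree; a root with a single child is internal.
    Leaf : V → Set
    Leaf n = ∀ n′ → ¬ Child n n′

    Descendant : V → V → Set
    Descendant n = Star Child n

-- Positive and negative occurrences.
Clause : ℕ → Set
Clause v = Subset v × Subset v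

vars : ∀ {v} → Clause v → Subset v
vars (pos , neg) = pos ∪ neg

-- A formula over X = Fin v, with vars(φ) = X.  The set of clauses is indexed
-- without repetition by Fin size, so an index stands for a clause.
record CNF (v : ℕ) : Set where
  field
    size     : ℕ
    clause   : Fin size → Clause v
    distinct : Injective _≡_ _≡_ clause
    occurs   : ∀ x → ∃[ c ] x ∈ˢ vars (clause c)

  varsOf : Fin size → Subset v
  varsOf c = vars (clause c)

gaifman : ∀ {v} → CNF v → Graph (Fin v)
gaifman φ = record
  { _~_      = λ x y → x ≢ y × ∃[ c ] (x ∈ˢ varsOf c × y ∈ˢ varsOf c)
  ; ~-sym    = λ (x≢y , c , x∈c , y∈c) → (λ y≡x → x≢y (sym y≡x)) , c , y∈c , x∈c
  ; ~-irrefl = λ x≡y (x≢y , _) → x≢y x≡y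
  }
  where open CNF φ

record TreeDecomposition {v : ℕ} (G : Graph (Fin v)) : Set₁ where
  field
    order  : ℕ
    S      : Graph (Fin order)
    isTree : IsTree S
    χ      : Fin order → Subset v
    vertex : ∀ x → ∃[ n ] x ∈ˢ χ n
    edge   : ∀ x y → Graph._~_ G x y → ∃[ n ] (x ∈ˢ χ n × y ∈ˢ χ n)
    convex : ∀ n o p (w : Walk S n p) → IsPath S w → o ∈ visited S w → χ n ∩ χ p ⊆ˢ χ o

  -- An integer, as the width is -1 when every bag is empty.
  width : ℤ
  width = + max 0 (map (λ n → ∣ χ n ∣) (allFin order)) - + 1

-- The labels γ and π are given together, by one map sending a node n to
-- inj₁ (γ n) if n is a leaf and to inj₂ (π n) if n is internal.
module _ {v : ℕ} (φ : CNF v) {V : Set} (T : Graph V) (r : V)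
         (label : V → Fin (CNF.size φ) ⊎ Subset v) where
  open CNF φ
  open Rooted T r

  record IsProjectJoinTree : Set where
    field
      isTree       : IsTree T
      leaf         : ∀ n → Leaf n ⇔ (∃[ c ] label n ≡ inj₁ c)
      γ-injective  : ∀ {n n′ c} → label n ≡ inj₁ c → label n′ ≡ inj₁ c → n ≡ n′
      γ-surjective : ∀ c → ∃[ n ] label n ≡ inj₁ c
      -- The blocks π(n) partition X = Fin v.
      π-nonempty   : ∀ {n A} → label n ≡ inj₂ A → Nonempty A
      π-disjoint   : ∀ {n n′ A A′ x} → label n ≡ inj₂ A → label n′ ≡ inj₂ A′ →
                     x ∈ˢ A → x ∈ˢ A′ → n ≡ n′
      π-covers     : ∀ x → ∃[ n ] ∃[ A ] (label n ≡ inj₂ A × x ∈ˢ A)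
      below        : ∀ {n A x c l} → label n ≡ inj₂ A → x ∈ˢ A → x ∈ˢ varsOf c →
                     label l ≡ inj₁ c → Descendant n l

  data _∈vars_ (x : Fin v) (n : V) : Set where
    leaf     : ∀ {c} → label n ≡ inj₁ c → x ∈ˢ varsOf c → x ∈vars n
    internal : ∀ {A o} → label n ≡ inj₂ A → Child n o → x ∈vars o → x ∉ˢ A → x ∈vars n

  -- The set whose cardinality is the size of n: vars(n) at a leaf,
  -- vars(n) ∪ π(n) at an internal node.
  _∈scope_ : Fin v → V → Set
  x ∈scope n = x ∈vars n ⊎ (∃[ A ] (label n ≡ inj₂ A × x ∈ˢ A))

  HasSize : V → ℕ → Set
  HasSize n k = ∃[ A ] ((∀ x → x ∈ˢ A ⇔ x ∈scope n) × ∣ A ∣ ≡ k)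

  HasWidth : ℕ → Set
  HasWidth k = (∃[ n ] HasSize n k) × (∀ n → ∃[ j ] (HasSize n j × j ≤ k))

-- The trees built by the algorithm, for m clauses over v variables.
data Tree (m v : ℕ) : Set where
  leaf : Fin m → Tree m v
  node : Subset v → List (Tree m v) → Tree m v

module _ {m v : ℕ} where

  data Node : Tree m v → Set where
    root  : ∀ {t} → Node t
    child : ∀ {A ts} (i : Fin (length ts)) → Node (lookup ts i) → Node (node A ts)

  data _⊳_ : ∀ {t} → Node t → Node t → Set where
    here  : ∀ {A ts} {i : Fin (length ts)} → _⊳_ {node A ts} root (child i root)
    there : ∀ {A ts} {i : Fin (length ts)} {n n′ : Node (lookup ts i)} →
            n ⊳ n′ → _⊳_ {node A ts} (child i n) (child i n′)

  ⊳-irrefl : ∀ {t} {n : Node t} → ¬ n ⊳ n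
  ⊳-irrefl (there p) = ⊳-irrefl p

  treeGraph : (t : Tree m v) → Graph (Node t)
  treeGraph t = record
    { _~_      = SymClosure _⊳_
    ; ~-sym    = symmetric _⊳_
    ; ~-irrefl = λ { refl (fwd p) → ⊳-irrefl p ; refl (bwd p) → ⊳-irrefl p }
    }

  treeLabel : (t : Tree m v) → Node t → Fin m ⊎ Subset v
  treeLabel (leaf c)    root        = inj₁ c
  treeLabel (node A _)  root        = inj₂ A
  treeLabel (node _ ts) (child i n) = treeLabel (lookup ts i) n

module Algorithm {v : ℕ} (φ : CNF v) (D : TreeDecomposition (gaifman φ))
                 (s : Fin (TreeDecomposition.order D)) where
  open CNF φ
  open TreeDecomposition D
  open Rooted S s
  open DecMembership (Fin._≟_ {size}) using (_∈?_)

  -- An order in which the children of each node of S are processed.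
  record ChildOrder : Set where
    field
      children : Fin order → List (Fin order)
      unique   : ∀ n → Unique (children n)
      exact    : ∀ n o → o ∈ children n ⇔ Child n o

  newClauses : Fin order → List (Fin size) → List (Fin size)
  newClauses n found = filter (λ c → ¬? (c ∈? found) ×-dec (varsOf c ⊆? χ n)) (allFin size)

  finish : Fin order → Subset v → List (Tree size v) → List (Tree size v)
  finish n ℓ ts = if null ts ∨ does (χ n ⊆? ℓ) then ts else [ node (χ n ─ ℓ) ts ]

  module _ (ord : ChildOrder) where
    open ChildOrder ord

    -- Process n ℓ found ts found′: the call Process(n, ℓ), started with the
    -- given value of the global variable, returns ts and leaves found′ in it.
    -- ProcessAll runs the calls for a list of nodes one after the other.
    data Process (n : Fin order) (ℓ : Subset v) (found : List (Fin size)) :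
                 List (Tree size v) → List (Fin size) → Set
    data ProcessAll (ℓ : Subset v) :
                    List (Fin order) → List (Fin size) → List (Tree size v) → List (Fin size) → Set

    data Process n ℓ found where
      process : ∀ {ts found′} →
                ProcessAll (χ n) (children n) (newClauses n found ++ found) ts found′ →
                Process n ℓ found (finish n ℓ (map leaf (newClauses n found) ++ ts)) found′

    data ProcessAll ℓ where
      []  : ∀ {found} → ProcessAll ℓ [] found [] found
      _∷_ : ∀ {o os found found′ found″ ts us} →
            Process o ℓ found ts found′ → ProcessAll ℓ os found′ us found″ →
            ProcessAll ℓ (o ∷ os) found (ts ++ us) found″

    Run : List (Tree size v) → Set
    Run ts = ∃[ found ] Process s Subset.⊥ [] ts found

{-# OPTIONS --safe #-}

-- Let the region of a call on n be the subtree of S below n.  The running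
-- intersection property says that a variable in a bag of the region and in a bag
-- outside it lies in χ n and in the parent's bag ℓ, so χ n ─ ℓ collects exactly
-- the variables of χ n that occur in no bag outside the region.  Every clause is
-- a clique of the Gaifman graph, hence contained in some bag; if it mentions a
-- projected variable, that bag is in the region and its leaf ends up below the
-- node.  Inductively the trees returned have variables in ℓ, so the scope of a
-- new node is contained in χ n.

module Submission where

open import Defs
open import Data.Empty using (⊥; ⊥-elim)
open import Data.Fin using (Fin; zero; suc)
open import Data.Fin.Induction using (po-wellFounded)
import Data.Fin.Properties as Fin
open import Data.Fin.Subset as Subset
  using (Subset; Nonempty; inside; outside; _∪_; _─_; ∣_∣)
  renaming (_∈_ to _∈ˢ_; _∉_ to _∉ˢ_; _⊆_ to _⊆ˢ_)
open import Data.Fin.Subset.Properties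
  using (_⊆?_; nonempty?; ∉⊥; p⊆q⇒∣p∣≤∣q∣; x∈p∩q⁺; x∈p∪q⁺; x∈p∪q⁻; p─q⊆p; x∈p∧x∉q⇒x∈p─q)
  renaming (_∈?_ to _∈ˢ?_)
open import Data.Integer as ℤ using (+_; _+_; -_; _≤_)
import Data.Integer.Properties as ℤ
open import Data.List using (List; []; _∷_; [_]; _++_; map; length; lookup; allFin)
open import Data.List.Extrema.Nat using (max; xs≤max)
import Data.List.Membership.DecPropositional as DecMembership
open import Data.List.Membership.Propositional using (_∈_; _∉_; lose)
open import Data.List.Membership.Propositional.Properties
  using (∈-++⁺ˡ; ∈-++⁺ʳ; ∈-++⁻; ∈-filter⁺; ∈-filter⁻; ∈-map⁺; ∈-allFin; ∈-lookup)
open import Data.List.Relation.Unary.All as All using (All; []; _∷_)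
import Data.List.Relation.Unary.All.Properties as All
open import Data.List.Relation.Unary.AllPairs as AllPairs using (AllPairs; []; _∷_)
import Data.List.Relation.Unary.AllPairs.Properties as AllPairs
open import Data.List.Relation.Unary.Any as Any using (Any; here; there)
import Data.List.Relation.Unary.Any.Properties as Any
open import Data.List.Relation.Unary.Unique.Propositional using (Unique)
import Data.List.Relation.Unary.Unique.Propositional.Properties as Unique
open import Data.Nat as ℕ using (ℕ; zero; suc; s≤s; z≤n)
import Data.Nat.Properties as ℕ
open import Data.Product as Product using (Σ; ∃-syntax; _×_; _,_; proj₁; proj₂)
open import Data.Sum as Sum using (_⊎_; inj₁; inj₂; [_,_]′)
open import Data.Unit using (⊤; tt)
open import Data.Vec.Base using ([]; _∷_; here; there)
open import Function using (_∘_; _⇔_; id; flip; mk⇔; Equivalence)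
open import Induction.WellFounded using (WellFounded; Acc; acc; module Subrelation)
open import Relation.Binary.Construct.Closure.ReflexiveTransitive as Star using (Star; ε; _◅_; _◅◅_)
open import Relation.Binary.Construct.Closure.Symmetric using (fwd; bwd)
open import Relation.Binary.Definitions using (DecidableEquality)
open import Relation.Binary.PropositionalEquality
  using (_≡_; _≢_; refl; sym; trans; cong; subst; isEquivalence)
open import Relation.Nullary using (¬_; ¬?; _×-dec_; _→-dec_; yes; no; contradiction)

-- Walks and rooted trees

-- The obstacle is the shared variable `found`. A clause may fit bags in the regions of two
-- siblings, and the call that runs earlier takes it; the calls in the other region must then
-- project none of its variables. They do not, because such a variable lies in bags of both regions,
-- hence in the parent's bag. Every claim about a call is therefore relative to `found` on entry and
-- exempts the clauses already in it, and the claims for siblings combine because their regions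
-- share only variables of `ℓ`. A second obstacle is that a call without children creates no node
-- even if `χ n` has variables outside `ℓ`. Then no clause outside `found` mentions such a variable,
-- since its leaf would be among the children. As `Process` is a relation, the existence of a run is
-- shown separately, by well-founded recursion down `S`.

∉⇒unique : ∀ {A : Set} {x : A} {xs} → x ∉ xs → Unique xs → Unique (x ∷ xs)
∉⇒unique x∉ p = All.¬Any⇒All¬ _ x∉ ∷ p

unique⇒∉ : ∀ {A : Set} {x : A} {xs} → Unique (x ∷ xs) → x ∉ xs
unique⇒∉ (x≢ ∷ _) = All.All¬⇒¬Any x≢

module WalkProperties {V : Set} (G : Graph V) where
  open Graph G

  start∈ : ∀ {u v} (w : Walk G u v) → u ∈ visited G w
  start∈ ε       = here refl
  start∈ (_ ◅ _) = here refl

  end∈ : ∀ {u v} (w : Walk G u v) → v ∈ visited G w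
  end∈ ε       = here refl
  end∈ (_ ◅ w) = there (end∈ w)

  visited-◅◅ : ∀ {u v t x} (w : Walk G u v) (w′ : Walk G v t) →
               x ∈ visited G (w ◅◅ w′) → x ∈ visited G w ⊎ x ∈ visited G w′
  visited-◅◅ ε       w′ x∈         = inj₂ x∈
  visited-◅◅ (_ ◅ w) w′ (here eq)  = inj₁ (here eq)
  visited-◅◅ (_ ◅ w) w′ (there x∈) with visited-◅◅ w w′ x∈
  ... | inj₁ x∈w  = inj₁ (there x∈w)
  ... | inj₂ x∈w′ = inj₂ x∈w′

  reverseWalk : ∀ {u v} → Walk G u v → Walk G v u
  reverseWalk ε       = ε
  reverseWalk (e ◅ w) = reverseWalk w ◅◅ (~-sym e ◅ ε)

  visited-reverse : ∀ {u v x} (w : Walk G u v) → x ∈ visited G (reverseWalk w) → x ∈ visited G w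
  visited-reverse ε       x∈ = x∈
  visited-reverse (e ◅ w) x∈ with visited-◅◅ (reverseWalk w) (~-sym e ◅ ε) x∈
  ... | inj₁ x∈w                = there (visited-reverse w x∈w)
  ... | inj₂ (here refl)         = there (start∈ w)
  ... | inj₂ (there (here refl)) = here refl

  suffix : ∀ {u v x} (w : Walk G u v) → x ∈ visited G w →
           Σ (Walk G x v) λ w′ → (∀ {y} → y ∈ visited G w′ → y ∈ visited G w) ×
                                 (IsPath G w → IsPath G w′)
  suffix ε       (here refl) = ε , (λ y∈ → y∈) , λ p → p
  suffix (e ◅ w) (here refl) = e ◅ w , (λ y∈ → y∈) , λ p → p
  suffix (e ◅ w) (there x∈)  with suffix w x∈
  ... | w′ , sub , path = w′ , there ∘ sub , λ { (_ ∷ p) → path p }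

  visited-length : ∀ {u v} (w : Walk G u v) → u ≢ v → 2 ℕ.≤ length (visited G w)
  visited-length ε             u≢v = contradiction refl u≢v
  visited-length (_ ◅ ε)       _   = s≤s (s≤s z≤n)
  visited-length (_ ◅ (_ ◅ _)) _   = s≤s (s≤s z≤n)

  module _ (_≟_ : DecidableEquality V) where
    open DecMembership _≟_ using (_∈?_)

    shorten : ∀ {u v} (w : Walk G u v) →
              Σ (Walk G u v) λ w′ → IsPath G w′ × (∀ {y} → y ∈ visited G w′ → y ∈ visited G w)
    shorten ε = ε , [] ∷ [] , λ y∈ → y∈
    shorten {u} (e ◅ w) with shorten w
    ... | w′ , path , sub with u ∈? visited G w′
    ...   | yes u∈ = let (w″ , sub′ , path′) = suffix w′ u∈ in
                     w″ , path′ path , there ∘ sub ∘ sub′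
    ...   | no  u∉ = e ◅ w′ , ∉⇒unique u∉ path ,
                     λ { (here eq) → here eq ; (there y∈) → there (sub y∈) }

    -- If m ≢ m′, the walk, cut down to a path, closes up to a cycle through n.
    neighbours-unseparated : ¬ Cycle G → ∀ {n m m′} → n ~ m → n ~ m′ →
                             (w : Walk G m m′) → n ∉ visited G w → m ≡ m′
    neighbours-unseparated acyclic {n} {m} {m′} n~m n~m′ w n∉ with m ≟ m′
    ... | yes m≡m′ = m≡m′
    ... | no  m≢m′ with shorten w
    ...   | p , path , sub =
      ⊥-elim (acyclic (n , m′ , n~m ◅ p , ∉⇒unique (n∉ ∘ sub) path ,
                       s≤s (visited-length p m≢m′) , ~-sym n~m′))

module RootedTree {k : ℕ} (S : Graph (Fin k)) (tree : IsTree S) (r : Fin k) where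
  open Graph S
  open Rooted S r
  open WalkProperties S

  private
    connected : Connected S
    connected = proj₁ tree

    unseparated : ∀ {n m m′} → n ~ m → n ~ m′ →
                  (w : Walk S m m′) → n ∉ visited S w → m ≡ m′
    unseparated = neighbours-unseparated Fin._≟_ (proj₂ tree)

  pathTo : ∀ u v → Σ (Walk S u v) (IsPath S)
  pathTo u v = let (w , path , _) = shorten Fin._≟_ (connected u v) in w , path

  -- A positive form of not being a descendant: avoiding walks can be composed, which a negation
  -- does not allow.
  Outside : Fin k → Fin k → Set
  Outside o b = Σ (Walk S b r) λ w → o ∉ visited S w

  child-≢ : ∀ {n o} → Child n o → n ≢ o
  child-≢ (n~o , _) n≡o = ~-irrefl n≡o n~o

  child-dominates : ∀ {n o} → Child n o → (w : Walk S o r) → n ∈ visited S w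
  child-dominates (_ , dom) w =
    let (p , path , sub) = shorten Fin._≟_ w in sub (dom p path)

  dominates : ∀ {o b} → Descendant o b → (w : Walk S b r) → o ∈ visited S w
  dominates ε       w = start∈ w
  dominates (c ◅ d) w =
    let (w′ , sub , _) = suffix w (dominates d w) in sub (child-dominates c w′)

  outside⇒¬descendant : ∀ {o b} → Outside o b → ¬ Descendant o b
  outside⇒¬descendant (w , o∉) d = o∉ (dominates d w)

  -- A path from `n` to the root starts with a step to some `m′`. The given walk, followed by the
  -- rest of that path backwards, joins `m` to `m′` without `n`, so acyclicity gives `m ≡ m′`.
  child-intro : ∀ {n m} → n ~ m → (w : Walk S m r) → n ∉ visited S w → Child m n
  child-intro {n} {m} n~m w n∉ = ~-sym n~m , on-path
    where
    on-path : (p : Walk S n r) → IsPath S p → m ∈ visited S p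
    on-path ε          _    = contradiction (end∈ w) n∉
    on-path (n~m′ ◅ p) path = there (subst (_∈ visited S p) (sym m≡m′) (start∈ p))
      where
      n∉w◅◅p : n ∉ visited S (w ◅◅ reverseWalk p)
      n∉w◅◅p n∈ with visited-◅◅ w (reverseWalk p) n∈
      ... | inj₁ n∈w = n∉ n∈w
      ... | inj₂ n∈p = unique⇒∉ path (visited-reverse p n∈p)
      m≡m′ = unseparated n~m n~m′ (w ◅◅ reverseWalk p) n∉w◅◅p

  parent-outside : ∀ {n o} → Child n o → Outside o n
  parent-outside {n} {o} c with pathTo o r
  ... | ε     , path = contradiction (child-dominates c ε) λ { (here n≡o) → child-≢ c n≡o }
  ... | e ◅ p , path with child-dominates c (e ◅ p)
  ...   | here n≡o = contradiction n≡o (child-≢ c)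
  ...   | there n∈ = let (p′ , sub , _) = suffix p n∈ in
                     p′ , unique⇒∉ path ∘ sub

  avoiding : ∀ {o a b} → Outside o a → Outside o b → Σ (Walk S a b) λ w → o ∉ visited S w
  avoiding (w , o∉w) (w′ , o∉w′) =
    w ◅◅ reverseWalk w′ ,
    [ o∉w , o∉w′ ∘ visited-reverse w′ ]′ ∘ visited-◅◅ w (reverseWalk w′)

  -- Two neighbours of `o` outside it are joined through the root by a walk avoiding `o`, so
  -- acyclicity identifies them; the parent is one such neighbour.
  neighbour-outside : ∀ {n m o} → Child n o → o ~ m → Outside o m → m ≡ n
  neighbour-outside c o~m out =
    let (w , o∉) = avoiding out (parent-outside c) in
    unseparated o~m (~-sym (proj₁ c)) w o∉

  parent-unique : ∀ {m n o} → Child m o → Child n o → m ≡ n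
  parent-unique c c′ = neighbour-outside c′ (~-sym (proj₁ c)) (parent-outside c)

  unsnoc : ∀ {o b} → Descendant o b → o ≡ b ⊎ ∃[ p ] (Descendant o p × Child p b)
  unsnoc ε       = inj₁ refl
  unsnoc (c ◅ d) with unsnoc d
  ... | inj₁ refl          = inj₂ (_ , ε , c)
  ... | inj₂ (p , d′ , c′) = inj₂ (p , c ◅ d′ , c′)

  -- Along a path to the root each node is a child of the next by `child-intro`, so meeting `o`
  -- makes `b` its descendant; otherwise the path itself avoids `o`.
  descendant-or-outside : ∀ o b → Descendant o b ⊎ Outside o b
  descendant-or-outside o b = let (w , path) = pathTo b r in go w path
    where
    go : ∀ {b} (w : Walk S b r) → IsPath S w → Descendant o b ⊎ Outside o b
    go {b} w path with o Fin.≟ b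
    go     w       path       | yes refl = inj₁ ε
    go     ε       path       | no o≢b   = inj₂ (ε , λ { (here o≡b) → o≢b o≡b })
    go (e ◅ w) path@(_ ∷ path′) | no o≢b with go w path′
    ... | inj₁ d =
      inj₁ (d ◅◅ child-intro e w (unique⇒∉ path) ◅ ε)
    ... | inj₂ (w′ , o∉) =
      inj₂ (e ◅ w′ , λ { (here o≡b) → o≢b o≡b ; (there o∈) → o∉ o∈ })

  root-ancestor : ∀ b → Descendant r b
  root-ancestor b with descendant-or-outside r b
  ... | inj₁ d        = d
  ... | inj₂ (w , r∉) = contradiction (end∈ w) r∉

  ¬descendant⇒outside : ∀ {o b} → ¬ Descendant o b → Outside o b
  ¬descendant⇒outside {o} {b} ¬d with descendant-or-outside o b
  ... | inj₁ d   = contradiction d ¬d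
  ... | inj₂ out = out

  -- Climb from `b` to the root: while `b` is neither sibling, both lines of descent pass through
  -- its unique parent. If one sibling is reached first, the other would be an ancestor of their
  -- parent `n`.
  siblings-disjoint : ∀ {n o o′ b} → Child n o → Child n o′ →
                      Descendant o b → Descendant o′ b → o ≡ o′
  siblings-disjoint {n} {o} {o′} {b} c c′ = let (w , path) = pathTo b r in go w path
    where
    go : ∀ {b} (w : Walk S b r) → IsPath S w → Descendant o b → Descendant o′ b → o ≡ o′
    go ε _ d d′ with dominates d ε | dominates d′ ε
    ... | here refl | here refl = refl
    go (e ◅ w) path@(_ ∷ path′) d d′
      with child-intro e w (unique⇒∉ path) | unsnoc d | unsnoc d′
    ... | cb | inj₁ refl         | inj₁ refl         = refl
    ... | cb | inj₁ refl         | inj₂ (_ , d₁ , c₁) with parent-unique c₁ c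
    ...   | refl = contradiction d₁ (outside⇒¬descendant (parent-outside c′))
    go (e ◅ w) path d d′ | cb | inj₂ (_ , d₁ , c₁) | inj₁ refl with parent-unique c₁ c′
    ...   | refl = contradiction d₁ (outside⇒¬descendant (parent-outside c))
    go (e ◅ w) (_ ∷ path′) d d′ | cb | inj₂ (_ , d₁ , c₁) | inj₂ (_ , d₂ , c₂)
      with parent-unique c₁ cb | parent-unique c₂ cb
    ... | refl | refl = go w path′ d₁ d₂

  -- If `b` came strictly later than `a` on a path from `a` to the root, the rest of the path from
  -- `b` would have to meet `a` again.
  descendant-antisym : ∀ {a b} → Descendant a b → Descendant b a → a ≡ b
  descendant-antisym {a} {b} d d′ with pathTo a r
  ... | w , path with dominates d′ w
  descendant-antisym d d′ | ε , path | here refl = refl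
  descendant-antisym d d′ | e ◅ w , path | here refl = refl
  descendant-antisym d d′ | e ◅ w , path | there b∈ =
    let (w′ , sub , _) = suffix w b∈ in
    contradiction (sub (dominates d w′)) (unique⇒∉ path)

  -- Strict descent is a strict partial order on a finite set. The relation is flipped so that
  -- recursion goes from a node to its children; it drives both the Helly argument and termination.
  child-wellFounded : WellFounded (flip Child)
  child-wellFounded = Subrelation.wellFounded
    (λ c → c ◅ ε , child-≢ c ∘ sym)
    (po-wellFounded {_⊑_ = flip Descendant} (record
      { isPreorder = record
        { isEquivalence = isEquivalence
        ; reflexive     = λ { refl → ε }
        ; trans         = λ d d′ → d′ ◅◅ d
        }
      ; antisym = λ d d′ → descendant-antisym d′ d
      }))

  -- Extended by a walk from `b` to the root avoiding `n`, the walk must meet `n`, and can do so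
  -- only before `b`.
  exit-through : ∀ {n a b} → Descendant n a → Outside n b → (w : Walk S a b) → n ∈ visited S w
  exit-through d (w′ , n∉) w with visited-◅◅ w w′ (dominates d (w ◅◅ w′))
  ... | inj₁ n∈ = n∈
  ... | inj₂ n∈ = contradiction n∈ n∉

  -- The path never returns to `n`, so its second node is already outside `n`, and the only such
  -- neighbour is the parent.
  exit-to-parent : ∀ {p n b} → Child p n → Outside n b →
                   (w : Walk S n b) → IsPath S w → p ∈ visited S w
  exit-to-parent c (w′ , n∉) ε _ = contradiction (start∈ w′) n∉
  exit-to-parent {p} {n} c (w′ , n∉) (e ◅ w) path = there (subst (_∈ visited S w) eq (start∈ w))
    where
    eq = neighbour-outside c e
      (w ◅◅ w′ , [ unique⇒∉ path , n∉ ]′ ∘ visited-◅◅ w w′)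

-- Separation and the Helly property in the tree decomposition

module DecompositionProperties {v : ℕ} (φ : CNF v) (D : TreeDecomposition (gaifman φ))
                               (s : Fin (TreeDecomposition.order D)) where
  open CNF φ
  open TreeDecomposition D
  open Rooted S s
  open RootedTree S isTree s

  -- Convexity is used twice: on the path from `a` to `b`, which passes `n`, and then on the path
  -- from `n` to `b`, which passes `p`.
  separates : ∀ {p n a b x} → Child p n → Descendant n a → ¬ Descendant n b →
              x ∈ˢ χ a → x ∈ˢ χ b → x ∈ˢ χ n × x ∈ˢ χ p
  separates {p} {n} {a} {b} c d ¬d x∈a x∈b =
    let out        = ¬descendant⇒outside ¬d
        (w , pw)   = pathTo a b
        x∈n        = convex a n b w pw (exit-through d out w) (x∈p∩q⁺ (x∈a , x∈b))
        (w′ , pw′) = pathTo n b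
    in x∈n , convex n p b w′ pw′ (exit-to-parent c out w′ pw′) (x∈p∩q⁺ (x∈n , x∈b))

  -- The Helly property of subtrees, by descent from the root: as long as the
  -- clause meets only bags at or below n, either χ n contains it, or a variable
  -- missing from χ n has all its bags, hence a bag of every other variable of
  -- the clause, below one child of n.
  clause-in-bag : ∀ c → ∃[ n ] varsOf c ⊆ˢ χ n
  clause-in-bag c = descend (child-wellFounded s) λ {x} _ →
      let (a , x∈a) = vertex x in a , root-ancestor a , x∈a
    where
    descend : ∀ {n} → Acc (flip Child) n →
              (∀ {x} → x ∈ˢ varsOf c → ∃[ a ] (Descendant n a × x ∈ˢ χ a)) →
              ∃[ m ] varsOf c ⊆ˢ χ m
    descend {n} (acc rec) occ with Fin.all? (λ x → (x ∈ˢ? varsOf c) →-dec (x ∈ˢ? χ n))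
    ... | yes c⊆n = n , λ {x} → c⊆n x
    ... | no  c⊈n with Fin.¬∀⟶∃¬ _ _ (λ x → (x ∈ˢ? varsOf c) →-dec (x ∈ˢ? χ n)) c⊈n
    ...   | y , y-bad with y ∈ˢ? varsOf c
    ...     | no  y∉c = contradiction (λ y∈c → contradiction y∈c y∉c) y-bad
    ...     | yes y∈c with occ y∈c
    ...       | a , ε      , y∈a = contradiction (λ _ → y∈a) y-bad
    ...       | a , ch ◅ d , y∈a = descend (rec ch) occ′
      where
      occ′ : ∀ {x} → x ∈ˢ varsOf c → ∃[ b ] (Descendant _ b × x ∈ˢ χ b)
      occ′ {x} x∈c with x Fin.≟ y
      ... | yes refl = a , d , y∈a
      ... | no x≢y with edge x y (x≢y , c , x∈c , y∈c)
      ...   | b , x∈b , y∈b with descendant-or-outside _ b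
      ...     | inj₁ d′  = b , d′ , x∈b
      ...     | inj₂ out =
        contradiction (λ _ → proj₂ (separates ch d (outside⇒¬descendant out) y∈a y∈b)) y-bad

-- The graph of a project-join tree

module _ {m v : ℕ} where

  depth : {t : Tree m v} → Node t → ℕ
  depth root        = 0
  depth (child _ n) = suc (depth n)

  ⊳-depth : {t : Tree m v} {n o : Node t} → n ⊳ o → depth o ≡ suc (depth n)
  ⊳-depth here      = refl
  ⊳-depth (there p) = cong suc (⊳-depth p)

  ⊳-deeper : {t : Tree m v} {n o : Node t} → n ⊳ o → depth n ℕ.< depth o
  ⊳-deeper p = ℕ.≤-reflexive (sym (⊳-depth p))

  ⊳-parent-unique : {t : Tree m v} {n n′ o : Node t} → n ⊳ o → n′ ⊳ o → n ≡ n′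
  ⊳-parent-unique here      here       = refl
  ⊳-parent-unique (there p) (there p′) = cong (child _) (⊳-parent-unique p p′)

  root-or-child : {t : Tree m v} (n : Node t) → n ≡ root ⊎ ∃[ p ] p ⊳ n
  root-or-child root        = inj₁ refl
  root-or-child (child i n) with root-or-child n
  ... | inj₁ refl    = inj₂ (root , here)
  ... | inj₂ (p , q) = inj₂ (child i p , there q)

  module TreeGraph (t : Tree m v) where
    private
      G = treeGraph t
    open WalkProperties G
    open Rooted G root

    -- The depth bound shows that the walk does not repeat its start, and later that no child of `n`
    -- lies on it.
    ascent : (n : Node t) → Σ (Walk G n root) λ w → IsPath G w × All (λ o → depth o ℕ.≤ depth n) (visited G w)
    ascent n = go (depth n) n refl
      where
      go : ∀ d n → depth n ≡ d →
           Σ (Walk G n root) λ w → IsPath G w × All (λ o → depth o ℕ.≤ d) (visited G w)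
      go d n eq with root-or-child n
      ... | inj₁ refl = ε , [] ∷ [] , ℕ.≤-reflexive eq ∷ []
      go zero n eq | inj₂ (p , q) with trans (sym (⊳-depth q)) eq
      ... | ()
      go (suc d) n eq | inj₂ (p , q) with go d p (ℕ.suc-injective (trans (sym (⊳-depth q)) eq))
      ... | w , path , below =
        bwd q ◅ w ,
        ∉⇒unique (λ n∈ → ℕ.<-irrefl refl (subst (ℕ._≤ d) eq (All.lookup below n∈))) path ,
        ℕ.≤-reflexive eq ∷ All.map ℕ.m≤n⇒m≤1+n below

    -- After a step down, a step up would revisit the unique parent.
    descent-stays-down : ∀ {u u′ v} → u ⊳ u′ → (w : Walk G u′ v) → IsPath G w → u ∉ visited G w →
      depth u ℕ.< depth v × ∃[ p ] (p ⊳ v × p ∈ u ∷ visited G w)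
    descent-stays-down q ε             _    _  = ⊳-deeper q , _ , q , here refl
    descent-stays-down q (fwd q′ ◅ w) path@(_ ∷ path′) u∉
      with descent-stays-down q′ w path′ (unique⇒∉ path)
    ... | deeper , p , r , p∈ = ℕ.<-trans (⊳-deeper q) deeper , p , r , there p∈
    descent-stays-down q (bwd q′ ◅ w) _ u∉ with ⊳-parent-unique q q′
    ... | refl = contradiction (there (start∈ w)) u∉

    -- A step down would force the path to enter `v` from its parent, which it avoids; so every step
    -- goes up.
    climbs : ∀ {u v} (w : Walk G u v) → IsPath G w → (∀ {p} → p ⊳ v → p ∉ visited G w) →
             depth v ℕ.≤ depth u
    climbs ε           _                _  = ℕ.≤-refl
    climbs (bwd q ◅ w) (_ ∷ path)       p∉ =
      ℕ.≤-trans (climbs w path λ r → p∉ r ∘ there) (ℕ.<⇒≤ (⊳-deeper q))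
    climbs (fwd q ◅ w) path@(_ ∷ path′) p∉
      with descent-stays-down q w path′ (unique⇒∉ path)
    ... | _ , p , r , p∈ = contradiction p∈ (p∉ r)

    -- The cases are the directions of the first step and of the closing edge. Each contradicts
    -- either the depths or the uniqueness of parents along a path.
    acyclic : ¬ Cycle G
    acyclic (u , v , ε , _ , s≤s () , _)
    acyclic (u , v , fwd q ◅ w , path@(_ ∷ path′) , _ , fwd r) =
      ℕ.<-asym (⊳-deeper r) (proj₁ (descent-stays-down q w path′ (unique⇒∉ path)))
    acyclic (u , v , fwd q ◅ ε , _ , s≤s (s≤s ()) , bwd r)
    -- The descent is taken from the second step on, so that the parent of `v` it yields, which is
    -- `u`, is a repetition rather than the start itself.
    acyclic (u , v , fwd q ◅ (fwd q′ ◅ w) , path@(_ ∷ path′@(_ ∷ path″)) , _ , bwd r)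
      with descent-stays-down q′ w path″ (unique⇒∉ path′)
    ... | _ , p , r′ , p∈ with ⊳-parent-unique r r′
    ...   | refl = unique⇒∉ path p∈
    acyclic (u , v , fwd q ◅ (bwd q′ ◅ w) , path , _ , bwd r) with ⊳-parent-unique q q′
    ... | refl = unique⇒∉ path (there (start∈ w))
    acyclic (u , v , bwd q ◅ ε , _ , s≤s (s≤s ()) , fwd r)
    acyclic (u , v , bwd q ◅ (_ ◅ w) , _ ∷ path , _ , fwd r) with ⊳-parent-unique q r
    ... | refl = unique⇒∉ path (end∈ w)
    acyclic (u , v , bwd q ◅ w , path@(_ ∷ path′) , _ , bwd r) =
      ℕ.<⇒≱ (ℕ.<-trans (⊳-deeper q) (⊳-deeper r))
        (climbs w path′ λ r′ p∈ → unique⇒∉ path (subst (_∈ visited G w) (⊳-parent-unique r′ r) p∈))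

    treeGraph-isTree : IsTree G
    treeGraph-isTree = (λ n o → proj₁ (ascent n) ◅◅ reverseWalk (proj₁ (ascent o))) , acyclic

    ⊳⇒child : ∀ {n o} → n ⊳ o → Child n o
    ⊳⇒child q = fwd q , on-path q
      where
      on-path : ∀ {n o} → n ⊳ o → (w : Walk G o root) → IsPath G w → n ∈ visited G w
      on-path () ε _
      on-path q (bwd r ◅ w) _ with ⊳-parent-unique q r
      ... | refl = there (start∈ w)
      -- A path that starts downwards ends at positive depth, hence not at the root.
      on-path q (fwd r ◅ w) path@(_ ∷ path′)
        with () ← proj₁ (descent-stays-down r w path′ (unique⇒∉ path))

    child⇒⊳ : ∀ {n o} → Child n o → n ⊳ o
    child⇒⊳ (fwd q , _)   = q
    child⇒⊳ {n} {o} (bwd q , dom) =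
      let (w , path , below) = ascent o in
      contradiction (All.lookup below (dom w path)) (ℕ.<⇒≱ (⊳-deeper q))

  -- Subtrees, extremal nodes and uniqueness of labels

  subtree : {t : Tree m v} → Node t → Tree m v
  subtree {t} root    = t
  subtree (child _ n) = subtree n

  label-subtree : {t : Tree m v} (n : Node t) → treeLabel t n ≡ treeLabel (subtree n) root
  label-subtree {t}         root        = refl
  label-subtree {node _ ts} (child i n) = label-subtree n

  ⊳-subtree : {t : Tree m v} {n o : Node t} → n ⊳ o →
              ∃[ A ] ∃[ ts ] ∃[ i ] (subtree n ≡ node A ts × subtree o ≡ lookup ts i)
  ⊳-subtree (here {A} {ts} {i}) = A , ts , i , refl , refl
  ⊳-subtree (there q)           = ⊳-subtree q

  subtree-child : {t : Tree m v} (n : Node t) {A : Subset v} {ts : List (Tree m v)} →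
                  subtree n ≡ node A ts → (i : Fin (length ts)) →
                  ∃[ o ] (n ⊳ o × subtree o ≡ lookup ts i)
  subtree-child {node _ _} root        refl i = child i root , here , refl
  subtree-child (child j n) eq   i =
    let (o , q , eq′) = subtree-child n eq i in child j o , there q , eq′

  lift-descendant : {A : Subset v} {ts : List (Tree m v)} {i : Fin (length ts)} {n o : Node (lookup ts i)} →
                    Star _⊳_ n o → Star (_⊳_ {m} {v} {node A ts}) (child i n) (child i o)
  lift-descendant = Star.gmap (child _) there

  root-descendant : {t : Tree m v} (n : Node t) → Star (_⊳_ {t = t}) root n
  root-descendant root        = ε
  root-descendant (child i n) = here ◅ lift-descendant (root-descendant n)

  -- `HasWidth` asks for a node attaining the maximum. In `argmaxAmong`, `b` is the value at the
  -- parent, which the children have to reach.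
  argmax : (t : Tree m v) (f : Node t → ℕ) → ∃[ n ] (∀ o → f o ℕ.≤ f n)
  argmaxAmong : (ts : List (Tree m v)) (f : ∀ i → Node (lookup ts i) → ℕ) (b : ℕ) →
                 (∀ i o → f i o ℕ.≤ b) ⊎
                 (∃[ i ] ∃[ n ] (b ℕ.≤ f i n × (∀ j o → f j o ℕ.≤ f i n)))
  argmax (leaf c)    f = root , λ { root → ℕ.≤-refl }
  argmax (node A ts) f with argmaxAmong ts (λ i n → f (child i n)) (f root)
  ... | inj₁ below               = root , λ { root → ℕ.≤-refl ; (child i o) → below i o }
  ... | inj₂ (i , n , b≤ , max) = child i n , λ { root → b≤ ; (child j o) → max j o }
  argmaxAmong []       f b = inj₁ λ ()
  argmaxAmong (t ∷ ts) f b with argmax t (f zero) | argmaxAmong ts (λ i → f (suc i)) b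
  ... | n , max | inj₁ below with ℕ.≤-total b (f zero n)
  ...   | inj₁ b≤ = inj₂ (zero , n , b≤ , λ { zero o → max o ; (suc j) o → ℕ.≤-trans (below j o) b≤ })
  ...   | inj₂ ≤b = inj₁ λ { zero o → ℕ.≤-trans (max o) ≤b ; (suc j) o → below j o }
  argmaxAmong (t ∷ ts) f b | n , max | inj₂ (i , n′ , b≤ , max′)
    with ℕ.≤-total (f zero n) (f (suc i) n′)
  ... | inj₁ ≤′ = inj₂ (suc i , n′ , b≤ ,
                        λ { zero o → ℕ.≤-trans (max o) ≤′ ; (suc j) o → max′ j o })
  ... | inj₂ ≥′ = inj₂ (zero , n , ℕ.≤-trans b≤ ≥′ ,
                        λ { zero o → max o ; (suc j) o → ℕ.≤-trans (max′ j o) ≥′ })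

  module _ (P : Fin m ⊎ Subset v → Set) where

    Has : Tree m v → Set
    Has t = ∃[ n ] P (treeLabel t n)

    AtMostOne : Tree m v → Set
    AtMostOne t = ∀ n o → P (treeLabel t n) → P (treeLabel t o) → n ≡ o

    -- Nodes of different trees have different types, so uniqueness across trees is stated through
    -- `Has`. Taking `P` to be a given clause label yields injectivity of γ; taking it to be the
    -- projection of a given variable yields disjointness of the blocks.
    AtMostOneAmong : List (Tree m v) → Set
    AtMostOneAmong ts = All AtMostOne ts × AllPairs (λ t u → Has t → ¬ Has u) ts

    any-has : ∀ {ts} (i : Fin (length ts)) → Has (lookup ts i) → Any Has ts
    any-has {_ ∷ _} zero    h = here h
    any-has {_ ∷ _} (suc i) h = there (any-has i h)

    has-node : ∀ {A ts} → Any Has ts → Has (node A ts)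
    has-node h = let (n , p) = Any.lookup-index {P = Has} h in child (Any.index h) n , p

    node-has : ∀ {A ts} → Has (node A ts) → P (inj₂ A) ⊎ Any Has ts
    node-has (root      , p) = inj₁ p
    node-has (child i n , p) = inj₂ (any-has i (n , p))

    atMostOne-node : ∀ {A ts} → AtMostOneAmong ts → (P (inj₂ A) → ¬ Any Has ts) →
                     AtMostOne (node A ts)
    atMostOne-node {A} {ts} one apart = λ
      { root        root        p q → refl
      ; root        (child j o) p q → contradiction (any-has j (o , q)) (apart p)
      ; (child i n) root        p q → contradiction (any-has i (n , p)) (apart q)
      ; (child i n) (child j o) p q → among one i n j o p q
      }
      where
      among : ∀ {ts} → AtMostOneAmong ts → (i : Fin (length ts)) (n : Node (lookup ts i))
              (j : Fin (length ts)) (o : Node (lookup ts j)) →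
              P (treeLabel _ n) → P (treeLabel _ o) → child {A = A} {ts} i n ≡ child j o
      among {_ ∷ _} (one ∷ _ , _) zero n zero o p q = cong (child zero) (one n o p q)
      among {_ ∷ _} (_ , apart ∷ _) zero n (suc j) o p q =
        contradiction (any-has j (o , q)) (All.All¬⇒¬Any (All.map (λ f → f (n , p)) apart))
      among {_ ∷ _} (_ , apart ∷ _) (suc i) n zero o p q =
        contradiction (any-has i (n , p)) (All.All¬⇒¬Any (All.map (λ f → f (o , q)) apart))
      among {_ ∷ _} (_ ∷ ones , _ ∷ aparts) (suc i) n (suc j) o p q
        with among (ones , aparts) i n j o p q
      ... | refl = refl

-- Variables and scopes by recursion on the tree

module Scopes {v : ℕ} (φ : CNF v) where
  open CNF φ

  treeVars : Tree size v → Subset v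
  forestVars : List (Tree size v) → Subset v
  treeVars (leaf c)    = varsOf c
  treeVars (node A ts) = forestVars ts ─ A
  forestVars []       = Subset.⊥
  forestVars (t ∷ ts) = treeVars t ∪ forestVars ts

  scope : Tree size v → Subset v
  scope (leaf c)    = varsOf c
  scope (node A ts) = forestVars ts ∪ A

  x∈p─q⇒x∉q : ∀ {k} {x : Fin k} (p q : Subset k) → x ∈ˢ p ─ q → x ∉ˢ q
  x∈p─q⇒x∉q (_      ∷ p) (inside  ∷ q) (there x∈) (there x∈q) = x∈p─q⇒x∉q p q x∈ x∈q
  x∈p─q⇒x∉q (_      ∷ p) (outside ∷ q) (there x∈) (there x∈q) = x∈p─q⇒x∉q p q x∈ x∈q

  forestVars-lookup : ∀ {x} ts (i : Fin (length ts)) →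
                      x ∈ˢ treeVars (lookup ts i) → x ∈ˢ forestVars ts
  forestVars-lookup (t ∷ ts) zero    x∈ = x∈p∪q⁺ (inj₁ x∈)
  forestVars-lookup (t ∷ ts) (suc i) x∈ = x∈p∪q⁺ (inj₂ (forestVars-lookup ts i x∈))

  forestVars⊆ : ∀ {ts A} → All (λ t → treeVars t ⊆ˢ A) ts → forestVars ts ⊆ˢ A
  forestVars⊆ []       x∈ = contradiction x∈ ∉⊥
  forestVars⊆ {t ∷ ts} (p ∷ ps) x∈ with x∈p∪q⁻ (treeVars t) (forestVars ts) x∈
  ... | inj₁ x∈t  = p x∈t
  ... | inj₂ x∈ts = forestVars⊆ ps x∈ts

  module _ (t : Tree size v) where
    open TreeGraph t
    open Rooted (treeGraph t) root
    private
      _∈ᵛ_ = _∈vars_ φ (treeGraph t) root (treeLabel t)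
      _∈ˢᶜ_ = _∈scope_ φ (treeGraph t) root (treeLabel t)

    leaf-subtree : ∀ n {c} → treeLabel t n ≡ inj₁ c → subtree n ≡ leaf c
    leaf-subtree n eq with subtree n | trans (sym (label-subtree n)) eq
    ... | leaf _ | refl = refl

    node-subtree : ∀ n {A} → treeLabel t n ≡ inj₂ A → ∃[ ts ] subtree n ≡ node A ts
    node-subtree n eq with subtree n | trans (sym (label-subtree n)) eq
    ... | node _ ts | refl = ts , refl

    vars-sound : ∀ {x n} → x ∈ᵛ n → x ∈ˢ treeVars (subtree n)
    inner-sound : ∀ {x n o A ts} → treeLabel t n ≡ inj₂ A → subtree n ≡ node A ts →
                  Child n o → x ∈ᵛ o → x ∈ˢ forestVars ts
    vars-sound {n = n} (leaf eq x∈) rewrite leaf-subtree n eq = x∈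
    vars-sound {n = n} (internal eq ch x∈ x∉A) with node-subtree n eq
    ... | ts , eq′ rewrite eq′ = x∈p∧x∉q⇒x∈p─q (inner-sound eq eq′ ch x∈) x∉A
    inner-sound eq eq′ ch x∈ with ⊳-subtree (child⇒⊳ ch)
    ... | A′ , ts′ , i , eqn , eqo with trans (sym eq′) eqn
    ...   | refl = forestVars-lookup ts′ i (subst (λ u → _ ∈ˢ treeVars u) eqo (vars-sound x∈))

    -- `u` is kept apart from `subtree n` to make the recursion structural; likewise
    -- `inner-complete` can pass to the tail of the list of children while `n` stays fixed.
    vars-complete : ∀ {x} u n → subtree n ≡ u → x ∈ˢ treeVars u → x ∈ᵛ n
    inner-complete : ∀ {x n} us → (∀ i → ∃[ o ] (n ⊳ o × subtree o ≡ lookup us i)) →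
                     x ∈ˢ forestVars us → ∃[ o ] (Child n o × x ∈ᵛ o)
    vars-complete (leaf c) n eq x∈ =
      leaf (trans (label-subtree n) (cong (λ u → treeLabel u root) eq)) x∈
    vars-complete (node A us) n eq x∈
      with inner-complete us (subtree-child n eq) (p─q⊆p (forestVars us) A x∈)
    ... | o , ch , x∈o =
      internal (trans (label-subtree n) (cong (λ u → treeLabel u root) eq)) ch x∈o
               (x∈p─q⇒x∉q (forestVars us) A x∈)
    inner-complete []       _  x∈ = contradiction x∈ ∉⊥
    inner-complete (u ∷ us) at x∈ with x∈p∪q⁻ (treeVars u) (forestVars us) x∈
    ... | inj₁ x∈u  = let (o , q , eq) = at zero in o , ⊳⇒child q , vars-complete u o eq x∈u
    ... | inj₂ x∈us = inner-complete us (at ∘ suc) x∈us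

    scope-correct : ∀ n x → x ∈ˢ scope (subtree n) ⇔ x ∈ˢᶜ n
    scope-correct n x = mk⇔ to from
      where
      to : x ∈ˢ scope (subtree n) → x ∈ˢᶜ n
      to x∈ with subtree n in eq
      ... | leaf c = inj₁ (vars-complete (leaf c) n eq x∈)
      ... | node A ts with x∈p∪q⁻ (forestVars ts) A x∈
      ...   | inj₂ x∈A  = inj₂ (A , trans (label-subtree n) (cong (λ u → treeLabel u root) eq) , x∈A)
      ...   | inj₁ x∈ts with x ∈ˢ? A
      ...     | yes x∈A = inj₂ (A , trans (label-subtree n) (cong (λ u → treeLabel u root) eq) , x∈A)
      ...     | no  x∉A = inj₁ (vars-complete (node A ts) n eq (x∈p∧x∉q⇒x∈p─q x∈ts x∉A))
      from : x ∈ˢᶜ n → x ∈ˢ scope (subtree n)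
      from (inj₁ (leaf eq x∈)) rewrite leaf-subtree n eq = x∈
      from (inj₁ (internal eq ch x∈ x∉A)) with node-subtree n eq
      ... | ts , eq′ rewrite eq′ = x∈p∪q⁺ (inj₁ (inner-sound eq eq′ ch x∈))
      from (inj₂ (A , eq , x∈A)) with node-subtree n eq
      ... | ts , eq′ rewrite eq′ = x∈p∪q⁺ (inj₂ x∈A)

-- The algorithm

atMostOneAmong-++ : ∀ {m v} (P : Fin m ⊎ Subset v → Set) {ts us} →
  AtMostOneAmong P ts → AtMostOneAmong P us → (Any (Has P) ts → ¬ Any (Has P) us) →
  AtMostOneAmong P (ts ++ us)
atMostOneAmong-++ P (ones , aparts) (ones′ , aparts′) cross =
  All.++⁺ ones ones′ ,
  AllPairs.++⁺ aparts aparts′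
    (All.tabulate λ t∈ → All.tabulate λ u∈ h h′ → cross (lose t∈ h) (lose u∈ h′))

module Correctness {v : ℕ} (φ : CNF v) (D : TreeDecomposition (gaifman φ))
                   (s : Fin (TreeDecomposition.order D))
                   (W : ℕ) (bag≤W : ∀ n → ∣ TreeDecomposition.χ D n ∣ ℕ.≤ W) where
  open CNF φ
  open TreeDecomposition D
  open Rooted S s
  open RootedTree S isTree s
  open DecompositionProperties φ D s
  open Algorithm φ D s
  open Scopes φ
  open DecMembership (Fin._≟_ {size}) using (_∈?_)

  -- The invariant of a call and its composition

  LabelledBy : Fin size → Fin size ⊎ Subset v → Set
  LabelledBy c l = l ≡ inj₁ c

  Projects : Fin v → Fin size ⊎ Subset v → Set
  Projects x l = ∃[ A ] (l ≡ inj₂ A × x ∈ˢ A)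

  HasLeaf : Fin size → Tree size v → Set
  HasLeaf c = Has (LabelledBy c)

  HasProjection : Fin v → Tree size v → Set
  HasProjection x = Has (Projects x)

  -- An internal node without children would be a graph leaf carrying no clause, and an empty block
  -- would spoil the partition.
  Proper : Tree size v → Set
  Proper (leaf _)    = ⊤
  Proper (node A ts) = ts ≢ [] × Nonempty A

  WellFormed : Tree size v → Set
  WellFormed t = ∀ (n : Node t) → Proper (subtree n) × ∣ scope (subtree n) ∣ ℕ.≤ W

  LeafBelow : Fin v → Fin size → Tree size v → Set
  LeafBelow x c t = ∀ (n : Node t) → Projects x (treeLabel t n) →
                    ∃[ l ] (Star _⊳_ n l × treeLabel t l ≡ inj₁ c)

  -- `Region` is a predicate so that one record serves a whole call, a list of sibling calls and the
  -- new leaves of a single bag. Clauses in `found` are exempt from `cover` and `below`, as their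
  -- leaves stand elsewhere.
  record Invariant (Region : Fin order → Set) (ℓ : Subset v)
                   (found found′ : List (Fin size)) (ts : List (Tree size v)) : Set where
    field
      found-sound : ∀ {c} → c ∈ found′ → c ∈ found ⊎ Any (HasLeaf c) ts
      found-mono  : ∀ {c} → c ∈ found → c ∈ found′
      leaf-found  : ∀ {c} → Any (HasLeaf c) ts → c ∈ found′
      leaf-fresh  : ∀ {c} → Any (HasLeaf c) ts → c ∉ found
      leaf-bag    : ∀ {c} → Any (HasLeaf c) ts → ∃[ a ] (Region a × varsOf c ⊆ˢ χ a)
      leaf-once   : ∀ c → AtMostOneAmong (LabelledBy c) ts
      complete    : ∀ {a c} → Region a → varsOf c ⊆ˢ χ a → c ∈ found′
      proj-bag    : ∀ {x} → Any (HasProjection x) ts → ∃[ a ] (Region a × x ∈ˢ χ a)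
      proj-fresh  : ∀ {x} → Any (HasProjection x) ts → x ∉ˢ ℓ
      proj-once   : ∀ x → AtMostOneAmong (Projects x) ts
      -- The clause c guarantees a leaf; above no leaf, no node is created.
      cover       : ∀ {a x c} → Region a → x ∈ˢ χ a → x ∉ˢ ℓ → x ∈ˢ varsOf c → c ∉ found →
                    Any (HasProjection x) ts
      below       : ∀ {x c} → x ∈ˢ varsOf c → c ∉ found → All (LeafBelow x c) ts
      wellFormed  : All WellFormed ts
      vars⊆ℓ      : All (λ t → treeVars t ⊆ˢ ℓ) ts

  open Invariant

  invariant-region : ∀ {R R′ ℓ f f′ ts} → (∀ {a} → R a → R′ a) → (∀ {a} → R′ a → R a) →
                     Invariant R ℓ f f′ ts → Invariant R′ ℓ f f′ ts
  invariant-region to from I = record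
    { found-sound = found-sound I
    ; found-mono  = found-mono I
    ; leaf-found  = leaf-found I
    ; leaf-fresh  = leaf-fresh I
    ; leaf-bag    = Product.map₂ (Product.map₁ to) ∘ leaf-bag I
    ; leaf-once   = leaf-once I
    ; complete    = complete I ∘ from
    ; proj-bag    = Product.map₂ (Product.map₁ to) ∘ proj-bag I
    ; proj-fresh  = proj-fresh I
    ; proj-once   = proj-once I
    ; cover       = cover I ∘ from
    ; below       = below I
    ; wellFormed  = wellFormed I
    ; vars⊆ℓ      = vars⊆ℓ I
    }

  invariant-[] : ∀ {ℓ f} → Invariant (λ _ → ⊥) ℓ f f []
  invariant-[] = record
    { found-sound = inj₁
    ; found-mono  = id
    ; leaf-found  = λ ()
    ; leaf-fresh  = λ ()
    ; leaf-bag    = λ ()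
    ; leaf-once   = λ _ → [] , []
    ; complete    = λ ()
    ; proj-bag    = λ ()
    ; proj-fresh  = λ ()
    ; proj-once   = λ _ → [] , []
    ; cover       = λ ()
    ; below       = λ _ _ → []
    ; wellFormed  = []
    ; vars⊆ℓ      = []
    }

  -- The last hypothesis confines shared variables to `ℓ`, while projected variables avoid `ℓ`;
  -- hence neither part projects a variable of the other's bags.
  invariant-++ : ∀ {R R′ ℓ f f₁ f₂ ts us} → Invariant R ℓ f f₁ ts → Invariant R′ ℓ f₁ f₂ us →
                 (∀ {a b x} → R a → R′ b → x ∈ˢ χ a → x ∈ˢ χ b → x ∈ˢ ℓ) →
                 Invariant (λ a → R a ⊎ R′ a) ℓ f f₂ (ts ++ us)
  invariant-++ {R} {R′} {ℓ} {f} {f₁} {f₂} {ts} {us} I J apart = record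
    { found-sound = [ Sum.map₂ Any.++⁺ˡ ∘ found-sound I , inj₂ ∘ Any.++⁺ʳ ts ]′ ∘ found-sound J
    ; found-mono  = found-mono J ∘ found-mono I
    ; leaf-found  = [ found-mono J ∘ leaf-found I , leaf-found J ]′ ∘ Any.++⁻ ts
    ; leaf-fresh  = [ leaf-fresh I , (λ h → leaf-fresh J h ∘ found-mono I) ]′ ∘ Any.++⁻ ts
    ; leaf-bag    = [ Product.map₂ (Product.map₁ inj₁) ∘ leaf-bag I
                    , Product.map₂ (Product.map₁ inj₂) ∘ leaf-bag J ]′ ∘ Any.++⁻ ts
    ; leaf-once   = λ c → atMostOneAmong-++ (LabelledBy c) (leaf-once I c) (leaf-once J c)
                            λ h h′ → leaf-fresh J h′ (leaf-found I h)
    ; complete    = complete-++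
    ; proj-bag    = [ Product.map₂ (Product.map₁ inj₁) ∘ proj-bag I
                    , Product.map₂ (Product.map₁ inj₂) ∘ proj-bag J ]′ ∘ Any.++⁻ ts
    ; proj-fresh  = [ proj-fresh I , proj-fresh J ]′ ∘ Any.++⁻ ts
    ; proj-once   = λ x → atMostOneAmong-++ (Projects x) (proj-once I x) (proj-once J x)
                            λ h h′ → let (_ , r , x∈) = proj-bag I h; (_ , r′ , x∈′) = proj-bag J h′ in
                                     proj-fresh J h′ (apart r r′ x∈ x∈′)
    ; cover       = cover-++
    ; below       = λ x∈c c∉f → All.++⁺ (below I x∈c c∉f) (below-J x∈c c∉f)
    ; wellFormed  = All.++⁺ (wellFormed I) (wellFormed J)
    ; vars⊆ℓ      = All.++⁺ (vars⊆ℓ I) (vars⊆ℓ J)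
    }
    where
    earlier : ∀ {c} → c ∉ f → c ∈ f₁ → Any (HasLeaf c) ts
    earlier c∉f c∈f₁ = [ flip contradiction c∉f , id ]′ (found-sound I c∈f₁)

    complete-++ : ∀ {a c} → R a ⊎ R′ a → varsOf c ⊆ˢ χ a → c ∈ f₂
    complete-++ (inj₁ r) sub = found-mono J (complete I r sub)
    complete-++ (inj₂ r) sub = complete J r sub

    cover-++ : ∀ {a x c} → R a ⊎ R′ a → x ∈ˢ χ a → x ∉ˢ ℓ → x ∈ˢ varsOf c → c ∉ f →
               Any (HasProjection x) (ts ++ us)
    cover-++ (inj₁ r) x∈ x∉ℓ x∈c c∉f = Any.++⁺ˡ (cover I r x∈ x∉ℓ x∈c c∉f)
    cover-++ {c = c} (inj₂ r) x∈ x∉ℓ x∈c c∉f with c ∈? f₁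
    ... | no  c∉f₁ = Any.++⁺ʳ ts (cover J r x∈ x∉ℓ x∈c c∉f₁)
    -- The first part took `c` in a bag of its own region. That bag contains `x`, so `x` is
    -- projected in `ts`.
    ... | yes c∈f₁ =
      let (_ , r′ , sub) = leaf-bag I (earlier c∉f c∈f₁) in
      Any.++⁺ˡ (cover I r′ (sub x∈c) x∉ℓ x∈c c∉f)

    below-J : ∀ {x c} → x ∈ˢ varsOf c → c ∉ f → All (LeafBelow x c) us
    below-J {x} {c} x∈c c∉f with c ∈? f₁
    ... | no  c∉f₁ = below J x∈c c∉f₁
    -- No node of `us` projects `x`: the bag that received `c` would put `x` in both regions, hence
    -- in `ℓ`.
    ... | yes c∈f₁ = All.tabulate λ u∈ n p →
      let (_ , r , sub)  = leaf-bag I (earlier c∉f c∈f₁)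
          h              = lose u∈ (n , p)
          (_ , r′ , x∈b) = proj-bag J h
      in contradiction (apart r r′ (sub x∈c) x∈b) (proj-fresh J h)

  module _ (n : Fin order) (f : List (Fin size)) where
    private
      new = newClauses n f
      new? = λ c → ¬? (c ∈? f) ×-dec (varsOf c ⊆? χ n)

      new⁻ : ∀ {c} → c ∈ new → c ∉ f × varsOf c ⊆ˢ χ n
      new⁻ c∈ = proj₂ (∈-filter⁻ new? {xs = allFin size} c∈)

      leaves⁻ : ∀ {c} → Any (HasLeaf c) (map leaf new) → c ∈ new
      leaves⁻ = Any.map (λ { (root , refl) → refl }) ∘ Any.map⁻

      leaves⁺ : ∀ {c} → c ∈ new → Any (HasLeaf c) (map leaf new)
      leaves⁺ = Any.map⁺ ∘ Any.map λ { refl → root , refl }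

      leaves-all : ∀ {P : Tree size v → Set} → (∀ {c} → c ∈ new → P (leaf c)) → All P (map leaf new)
      leaves-all p = All.map⁺ (All.tabulate p)

      no-projection : ∀ {x} → ¬ Any (HasProjection x) (map leaf new)
      no-projection = All.All¬⇒¬Any (leaves-all λ { _ (root , _ , () , _) })

      new-unique : Unique new
      new-unique = Unique.filter⁺ new? (Unique.allFin⁺ size)

    -- With `χ n` in the role of `ℓ`, nothing is due for projection yet, and `cover` is vacuous.
    invariant-leaves : Invariant (_≡ n) (χ n) f (new ++ f) (map leaf new)
    invariant-leaves = record
      { found-sound = [ inj₂ ∘ leaves⁺ , inj₁ ]′ ∘ ∈-++⁻ new
      ; found-mono  = ∈-++⁺ʳ new
      ; leaf-found  = ∈-++⁺ˡ ∘ leaves⁻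
      ; leaf-fresh  = λ h → proj₁ (new⁻ (leaves⁻ h))
      ; leaf-bag    = λ h → n , refl , proj₂ (new⁻ (leaves⁻ h))
      ; leaf-once   = λ c → leaves-all (λ { _ root root _ _ → refl }) ,
                            AllPairs.map⁺ (AllPairs.map (λ { d≢e (root , refl) (root , refl) → d≢e refl }) new-unique)
      ; complete    = complete-leaves
      ; proj-bag    = flip contradiction no-projection
      ; proj-fresh  = flip contradiction no-projection
      ; proj-once   = λ x → leaves-all (λ { _ root root _ _ → refl }) ,
                            AllPairs.map⁺ (AllPairs.map (λ { _ (root , _ , () , _) _ }) new-unique)
      ; cover       = λ { refl x∈ x∉ _ _ → contradiction x∈ x∉ }
      ; below       = λ _ _ → leaves-all λ { _ root (_ , () , _) }
      ; wellFormed  = leaves-all λ { c∈ root → tt , ℕ.≤-trans (p⊆q⇒∣p∣≤∣q∣ (proj₂ (new⁻ c∈))) (bag≤W n) }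
      ; vars⊆ℓ      = leaves-all λ c∈ → proj₂ (new⁻ c∈)
      }
      where
      complete-leaves : ∀ {a c} → a ≡ n → varsOf c ⊆ˢ χ a → c ∈ new ++ f
      complete-leaves {c = c} refl sub with c ∈? f
      ... | yes c∈f = ∈-++⁺ʳ new c∈f
      ... | no  c∉f = ∈-++⁺ˡ (∈-filter⁺ new? (∈-allFin c) (c∉f , λ {_} → sub))

  -- All that a call has to know about `ℓ`. It treats alike the root, where `ℓ` is empty and no bag
  -- is outside, and a child, where `ℓ` is the parent's bag.
  record Interface (n : Fin order) (ℓ : Subset v) : Set where
    field
      enter : ∀ {a x} → Descendant n a → x ∈ˢ χ a → x ∈ˢ ℓ → x ∈ˢ χ n
      exit  : ∀ {a b x} → Descendant n a → ¬ Descendant n b → x ∈ˢ χ a → x ∈ˢ χ b → x ∈ˢ ℓ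

  root-interface : Interface s Subset.⊥
  root-interface = record
    { enter = λ _ _ x∈⊥ → contradiction x∈⊥ ∉⊥
    ; exit  = λ _ ¬d _ _ → contradiction (root-ancestor _) ¬d
    }

  child-interface : ∀ {p n} → Child p n → Interface n (χ p)
  child-interface c = record
    { enter = λ d x∈a x∈p → proj₁ (separates c d (outside⇒¬descendant (parent-outside c)) x∈a x∈p)
    ; exit  = λ d ¬d x∈a x∈b → proj₂ (separates c d ¬d x∈a x∈b)
    }

  module _ {n : Fin order} {ℓ : Subset v} {f f′ : List (Fin size)}
           (interface : Interface n ℓ) where
    open Interface interface

    projected-clause-below : ∀ {us} → Invariant (Descendant n) (χ n) f f′ us →
      ∀ {x c} → x ∈ˢ χ n → x ∉ˢ ℓ → x ∈ˢ varsOf c → c ∉ f → Any (HasLeaf c) us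
    projected-clause-below I {x} {c} x∈n x∉ℓ x∈c c∉f with clause-in-bag c
    ... | b , sub with descendant-or-outside n b
    ...   | inj₂ out = contradiction (exit ε (outside⇒¬descendant out) x∈n (sub x∈c)) x∉ℓ
    ...   | inj₁ d   = [ flip contradiction c∉f , id ]′ (found-sound I (complete I d sub))

    -- Replacing `χ n` by `ℓ` asks `cover` for the variables of `χ n` outside `ℓ`, which no new node
    -- projects. The second hypothesis says that no clause requires them: either there is no child
    -- to hold its leaf, or `χ n` is contained in `ℓ`.
    invariant-returned : ∀ {us} → Invariant (Descendant n) (χ n) f f′ us →
      (∀ {x c} → x ∈ˢ χ n → x ∉ˢ ℓ → x ∈ˢ varsOf c → c ∉ f → ⊥) →
      All (λ t → treeVars t ⊆ˢ ℓ) us →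
      Invariant (Descendant n) ℓ f f′ us
    invariant-returned {us} I nothing vars⊆ = record
      { found-sound = found-sound I
      ; found-mono  = found-mono I
      ; leaf-found  = leaf-found I
      ; leaf-fresh  = leaf-fresh I
      ; leaf-bag    = leaf-bag I
      ; leaf-once   = leaf-once I
      ; complete    = complete I
      ; proj-bag    = proj-bag I
      ; proj-fresh  = λ h x∈ℓ → let (_ , d , x∈) = proj-bag I h in proj-fresh I h (enter d x∈ x∈ℓ)
      ; proj-once   = proj-once I
      ; cover       = λ d x∈a x∉ℓ x∈c c∉f → cover I d x∈a (λ x∈n → nothing x∈n x∉ℓ x∈c c∉f) x∈c c∉f
      ; below       = below I
      ; wellFormed  = wellFormed I
      ; vars⊆ℓ      = vars⊆
      }

    invariant-node : ∀ {us} → Invariant (Descendant n) (χ n) f f′ us → us ≢ [] → ¬ χ n ⊆ˢ ℓ →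
                     Invariant (Descendant n) ℓ f f′ [ node (χ n ─ ℓ) us ]
    invariant-node {us} I us≢[] χ⊈ℓ = record
      { found-sound = λ {c} → Sum.map₂ (λ h → here (has-node (LabelledBy c) h)) ∘ found-sound I
      ; found-mono  = found-mono I
      ; leaf-found  = leaf-found I ∘ leaf⁻
      ; leaf-fresh  = leaf-fresh I ∘ leaf⁻
      ; leaf-bag    = leaf-bag I ∘ leaf⁻
      ; leaf-once   = λ c → atMostOne-node (LabelledBy c) (leaf-once I c) (λ ()) ∷ [] , [] ∷ []
      ; complete    = complete I
      ; proj-bag    = [ (λ x∈ → n , ε , p─q⊆p (χ n) ℓ x∈) , proj-bag I ]′ ∘ proj⁻
      ; proj-fresh  = [ x∈p─q⇒x∉q (χ n) ℓ
                      , (λ h x∈ℓ → let (_ , d , x∈) = proj-bag I h in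
                                   proj-fresh I h (enter d x∈ x∈ℓ)) ]′ ∘ proj⁻
      -- The new block lies in `χ n`, which all projections further down avoid.
      ; proj-once   = λ x → atMostOne-node (Projects x) (proj-once I x)
                              (λ { (_ , refl , x∈) h → proj-fresh I h (p─q⊆p (χ n) ℓ x∈) }) ∷ [] , [] ∷ []
      ; cover       = cover-node
      ; below       = λ x∈c c∉f → below-node x∈c c∉f ∷ []
      ; wellFormed  = wellFormed-node ∷ []
      ; vars⊆ℓ      = vars⊆ℓ-node ∷ []
      }
      where
      leaf⁻ : ∀ {c} → Any (HasLeaf c) [ node (χ n ─ ℓ) us ] → Any (HasLeaf c) us
      leaf⁻ (here h) with node-has (LabelledBy _) h
      ... | inj₂ h′ = h′

      proj⁻ : ∀ {x} → Any (HasProjection x) [ node (χ n ─ ℓ) us ] →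
              x ∈ˢ χ n ─ ℓ ⊎ Any (HasProjection x) us
      proj⁻ (here h) with node-has (Projects _) h
      ... | inj₁ (_ , refl , x∈) = inj₁ x∈
      ... | inj₂ h′              = inj₂ h′

      cover-node : ∀ {a x c} → Descendant n a → x ∈ˢ χ a → x ∉ˢ ℓ → x ∈ˢ varsOf c → c ∉ f →
                   Any (HasProjection x) [ node (χ n ─ ℓ) us ]
      cover-node {x = x} d x∈a x∉ℓ x∈c c∉f with x ∈ˢ? χ n
      ... | yes x∈n = here (root , _ , refl , x∈p∧x∉q⇒x∈p─q x∈n x∉ℓ)
      ... | no  x∉n = here (has-node (Projects x) (cover I d x∈a x∉n x∈c c∉f))

      below-node : ∀ {x c} → x ∈ˢ varsOf c → c ∉ f → LeafBelow x c (node (χ n ─ ℓ) us)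
      below-node x∈c c∉f root (_ , refl , x∈) =
        let (l , eq) = has-node (LabelledBy _)
              (projected-clause-below I (p─q⊆p (χ n) ℓ x∈) (x∈p─q⇒x∉q (χ n) ℓ x∈) x∈c c∉f)
        in l , root-descendant l , eq
      below-node x∈c c∉f (child i o) p =
        let (l , d , eq) = All.lookup (below I x∈c c∉f) (∈-lookup i) o p
        in child i l , lift-descendant d , eq

      vars⊆χ : forestVars us ⊆ˢ χ n
      vars⊆χ = forestVars⊆ (vars⊆ℓ I)

      vars⊆ℓ-node : forestVars us ─ (χ n ─ ℓ) ⊆ˢ ℓ
      vars⊆ℓ-node {x} x∈ with x ∈ˢ? ℓ
      ... | yes x∈ℓ = x∈ℓ
      ... | no  x∉ℓ = contradiction (x∈p∧x∉q⇒x∈p─q (vars⊆χ (p─q⊆p (forestVars us) _ x∈)) x∉ℓ)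
                                    (x∈p─q⇒x∉q (forestVars us) (χ n ─ ℓ) x∈)

      scope⊆χ : forestVars us ∪ (χ n ─ ℓ) ⊆ˢ χ n
      scope⊆χ = [ vars⊆χ , p─q⊆p (χ n) ℓ ]′ ∘ x∈p∪q⁻ (forestVars us) (χ n ─ ℓ)

      block-nonempty : Nonempty (χ n ─ ℓ)
      block-nonempty with nonempty? (χ n ─ ℓ)
      ... | yes ne = ne
      ... | no  ¬ne = ⊥-elim (χ⊈ℓ χ⊆ℓ)
        where
        χ⊆ℓ : χ n ⊆ˢ ℓ
        χ⊆ℓ {x} x∈ with x ∈ˢ? ℓ
        ... | yes x∈ℓ = x∈ℓ
        ... | no  x∉ℓ = contradiction (x , x∈p∧x∉q⇒x∈p─q x∈ x∉ℓ) ¬ne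

      wellFormed-node : WellFormed (node (χ n ─ ℓ) us)
      wellFormed-node root        = (us≢[] , block-nonempty) , ℕ.≤-trans (p⊆q⇒∣p∣≤∣q∣ scope⊆χ) (bag≤W n)
      wellFormed-node (child i o) = All.lookup (wellFormed I) (∈-lookup i) o

    invariant-finish : ∀ {us} → Invariant (Descendant n) (χ n) f f′ us →
                       Invariant (Descendant n) ℓ f f′ (finish n ℓ us)
    invariant-finish {[]} I =
      invariant-returned I (λ x∈n x∉ℓ x∈c c∉f → case-[] (projected-clause-below I x∈n x∉ℓ x∈c c∉f)) []
      where
      case-[] : ∀ {P : Tree size v → Set} → ¬ Any P []
      case-[] ()
    invariant-finish {_ ∷ _} I with χ n ⊆? ℓ
    ... | yes χ⊆ℓ = invariant-returned I (λ x∈n x∉ℓ _ _ → x∉ℓ (χ⊆ℓ x∈n))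
                                         (All.map (λ sub {_} x∈ → χ⊆ℓ (sub x∈)) (vars⊆ℓ I))
    ... | no  χ⊈ℓ = invariant-node I (λ ()) χ⊈ℓ

  -- Runs of the whole algorithm

  module _ (ord : ChildOrder) where
    open ChildOrder ord

    children⇒child : ∀ n → All (Child n) (children n)
    children⇒child n = All.tabulate λ o∈ → Equivalence.to (exact n _) o∈

    process-invariant : ∀ {n ℓ f f′ ts} → Interface n ℓ → Process ord n ℓ f ts f′ →
                        Invariant (Descendant n) ℓ f f′ ts
    processAll-invariant : ∀ {n os f f′ ts} → All (Child n) os → Unique os →
                           ProcessAll ord (χ n) os f ts f′ →
                           Invariant (λ a → Any (λ o → Descendant o a) os) (χ n) f f′ ts
    process-invariant {n} {f = f} interface (process ps) =
      invariant-finish interface (invariant-region to from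
        (invariant-++ (invariant-leaves n f)
          (processAll-invariant (children⇒child n) (unique n) ps) λ { refl _ x∈ _ → x∈ }))
      where
      to : ∀ {a} → a ≡ n ⊎ Any (λ o → Descendant o a) (children n) → Descendant n a
      to (inj₁ refl) = ε
      to (inj₂ d∈)   = let (c , d) = All.lookupAny (children⇒child n) d∈ in c ◅ d
      from : ∀ {a} → Descendant n a → a ≡ n ⊎ Any (λ o → Descendant o a) (children n)
      from ε       = inj₁ refl
      from (c ◅ d) = inj₂ (lose (Equivalence.from (exact n _) c) d)
    processAll-invariant _ _ [] = invariant-region (λ ()) (λ ()) invariant-[]
    processAll-invariant {n} {o ∷ os} (c ∷ cs) (o∉ ∷ u) (p ∷ ps) =
      invariant-region [ here , there ]′ (λ { (here d) → inj₁ d ; (there d) → inj₂ d })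
        (invariant-++ (process-invariant (child-interface c) p) (processAll-invariant cs u ps) apart)
      where
      apart : ∀ {a b x} → Descendant o a → Any (λ o′ → Descendant o′ b) os →
              x ∈ˢ χ a → x ∈ˢ χ b → x ∈ˢ χ n
      apart d d∈ x∈a x∈b = proj₂ (separates c d ¬d x∈a x∈b)
        where
        ¬d : ¬ Descendant o _
        ¬d d′ = All.All¬⇒¬Any o∉ (distinct-or-equal cs d∈)
          where
          distinct-or-equal : ∀ {os′} → All (Child n) os′ → Any (λ o′ → Descendant o′ _) os′ → o ∈ os′
          distinct-or-equal (c′ ∷ _)  (here d″)  = here (siblings-disjoint c c′ d′ d″)
          distinct-or-equal (_ ∷ cs′) (there d∈) = there (distinct-or-equal cs′ d∈)

    -- Both `ℓ` and `f` are arbitrary, since the `found` passed to a call depends on the earlier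
    -- siblings.
    Terminates : Fin order → Set
    Terminates n = ∀ ℓ f → ∃[ ts ] ∃[ f′ ] Process ord n ℓ f ts f′

    processAll-exists : ∀ {os} → All Terminates os → ∀ ℓ f →
                        ∃[ ts ] ∃[ f′ ] ProcessAll ord ℓ os f ts f′
    processAll-exists []       ℓ f = _ , _ , []
    processAll-exists (t ∷ ts) ℓ f =
      let (_ , f₁ , p) = t ℓ f
          (_ , _ , ps) = processAll-exists ts ℓ f₁
      in _ , _ , p ∷ ps

    process-exists : ∀ {n} → Acc (flip Child) n → Terminates n
    process-exists {n} (acc rec) ℓ f =
      let (_ , _ , ps) = processAll-exists (All.map (λ c → process-exists (rec c)) (children⇒child n))
                                           (χ n) _
      in _ , _ , process ps

    run-invariant : ∀ {ts} → Run ord ts → ∃[ f ] Invariant (Descendant s) Subset.⊥ [] f ts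
    run-invariant (f , p) = f , process-invariant root-interface p

    run-exists : ∃[ ts ] Run ord ts
    run-exists = process-exists (child-wellFounded s) Subset.⊥ []

    run-places : ∀ {ts} → Run ord ts → ∀ c → Any (HasLeaf c) ts
    run-places run c with run-invariant run | clause-in-bag c
    ... | f , I | b , sub with found-sound I (complete I (root-ancestor b) sub)
    ...   | inj₂ h = h

    finish-shape : ∀ {n ℓ} us → ¬ χ n ⊆ˢ ℓ → finish n ℓ us ≡ [] ⊎ ∃[ t ] finish n ℓ us ≡ [ t ]
    finish-shape []                   χ⊈ℓ = inj₁ refl
    finish-shape {n} {ℓ} (_ ∷ _) χ⊈ℓ with χ n ⊆? ℓ
    ... | yes χ⊆ℓ = ⊥-elim (χ⊈ℓ χ⊆ℓ)
    ... | no  _   = inj₂ (_ , refl)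

    -- An empty root bag would let the children be returned unwrapped, possibly several of them. A
    -- variable in the root bag excludes this, and a clause in which it occurs has a leaf, so the
    -- list is not empty either.
    run-singleton : Nonempty (χ s) → ∀ ts → Run ord ts → ∃[ t ] ts ≡ [ t ]
    run-singleton (x , x∈) _ run@(_ , process {us} _)
      with finish-shape (map leaf (newClauses s []) ++ us) (λ χ⊆⊥ → ∉⊥ (χ⊆⊥ x∈))
    ... | inj₂ single = single
    ... | inj₁ empty  with occurs x
    ...   | c , _ with subst (Any (HasLeaf c)) empty (run-places run c)
    ...     | ()

    module _ {t : Tree size v} (run : Run ord [ t ]) where
      open TreeGraph t
      private
        module Joined = Rooted (treeGraph t) root
        I = proj₂ (run-invariant run)

        wf : WellFormed t
        wf = All.head (wellFormed I)

      leaf⇒clause : ∀ n → Joined.Leaf n → ∃[ c ] treeLabel t n ≡ inj₁ c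
      leaf⇒clause n childless with treeLabel t n in eq
      ... | inj₁ c = c , refl
      ... | inj₂ A with node-subtree t n eq
      ...   | [] , eq′ = contradiction refl (proj₁ (subst Proper eq′ (proj₁ (wf n))))
      ...   | _ ∷ _ , eq′ with subtree-child n eq′ zero
      ...     | o , q , _ = contradiction (⊳⇒child q) (childless o)

      clause⇒leaf : ∀ n → ∃[ c ] treeLabel t n ≡ inj₁ c → Joined.Leaf n
      clause⇒leaf n (c , eq) o ch with ⊳-subtree (child⇒⊳ ch)
      ... | _ , _ , _ , eq′ , _ with trans (sym (leaf-subtree t n eq)) eq′
      ...   | ()

      γ-injective : ∀ {n o c} → treeLabel t n ≡ inj₁ c → treeLabel t o ≡ inj₁ c → n ≡ o
      γ-injective {n} {o} {c} = All.head (proj₁ (leaf-once I c)) n o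

      γ-surjective : ∀ c → ∃[ n ] treeLabel t n ≡ inj₁ c
      γ-surjective c with run-places run c
      ... | here h = h

      π-nonempty : ∀ {n A} → treeLabel t n ≡ inj₂ A → Nonempty A
      π-nonempty {n} eq with node-subtree t n eq
      ... | _ , eq′ = proj₂ (subst Proper eq′ (proj₁ (wf n)))

      π-covers : ∀ x → ∃[ n ] ∃[ A ] (treeLabel t n ≡ inj₂ A × x ∈ˢ A)
      π-covers x with vertex x | occurs x
      -- At the root `ℓ` and the initial `found` are empty and the region is all of `S`, so `cover`
      -- reaches every variable.
      ... | a , x∈a | c , x∈c with cover I (root-ancestor a) x∈a ∉⊥ x∈c (λ ())
      ...   | here h = h

      below-projection : ∀ {n A x c l} → treeLabel t n ≡ inj₂ A → x ∈ˢ A → x ∈ˢ varsOf c →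
                         treeLabel t l ≡ inj₁ c → Joined.Descendant n l
      below-projection {n} {l = l} eqn x∈A x∈c eql
        with All.head (below I x∈c (λ ())) n (_ , eqn , x∈A)
      ... | l′ , d , eql′ with γ-injective {l′} {l} eql′ eql
      ...   | refl = Star.map ⊳⇒child d

      run-projectJoinTree : IsProjectJoinTree φ (treeGraph t) root (treeLabel t)
      run-projectJoinTree = record
        { isTree       = treeGraph-isTree
        ; leaf         = λ n → mk⇔ (leaf⇒clause n) (clause⇒leaf n)
        ; γ-injective  = λ {n} {o} → γ-injective {n} {o}
        ; γ-surjective = γ-surjective
        ; π-nonempty   = λ {n} → π-nonempty {n}
        ; π-disjoint   = λ {n} {o} {x = x} eq eq′ x∈ x∈′ →
                           All.head (proj₁ (proj-once I x)) n o (_ , eq , x∈) (_ , eq′ , x∈′)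
        ; π-covers     = π-covers
        ; below        = λ {n} {l = l} → below-projection {n} {l = l}
        }

      run-width : ∃[ k ] (HasWidth φ (treeGraph t) root (treeLabel t) k × k ℕ.≤ W)
      run-width with argmax t (λ n → ∣ scope (subtree n) ∣)
      ... | n , max =
        ∣ scope (subtree n) ∣ , ((n , size-of n) , λ o → _ , size-of o , max o) , proj₂ (wf n)
        where
        size-of : ∀ o → HasSize φ (treeGraph t) root (treeLabel t) o ∣ scope (subtree o) ∣
        size-of o = scope (subtree o) , scope-correct t o , refl

theorem4 : ∀ {v : ℕ} (φ : CNF v) (D : TreeDecomposition (gaifman φ)) →
    let open TreeDecomposition D in
    (s : Fin order) →
    let open Algorithm φ D s in
    (ord : ChildOrder) →
    (∃[ ts ] Run ord ts) ×
    (Nonempty (χ s) → ∀ ts → Run ord ts → ∃[ t ] ts ≡ [ t ]) ×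
    (∀ t → Run ord [ t ] →
    IsProjectJoinTree φ (treeGraph t) root (treeLabel t) ×
    (∃[ k ] (HasWidth φ (treeGraph t) root (treeLabel t) k × + k ≤ width + + 1)))
theorem4 φ D s ord =
  run-exists ord , run-singleton ord , λ t run →
    run-projectJoinTree ord run ,
    (let (k , hasWidth , k≤W) = run-width ord run in
     k , hasWidth , subst (+ k ≤_) (sym width+1≡W) (ℤ.+≤+ k≤W))
  where
  open TreeDecomposition D
  sizes = map (λ n → ∣ χ n ∣) (allFin order)
  -- The largest bag size, that is, the width of the decomposition plus one.
  W = max 0 sizes

  bag≤W : ∀ n → ∣ χ n ∣ ℕ.≤ W
  bag≤W n = All.lookup (xs≤max 0 sizes) (∈-map⁺ (λ n → ∣ χ n ∣) (∈-allFin n))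

  width+1≡W : width + + 1 ≡ + W
  width+1≡W = trans (ℤ.+-assoc (+ W) (- + 1) (+ 1)) (ℤ.+-identityʳ (+ W))

  open Correctness φ D s W bag≤W
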